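{- Let $s_l=(a_j)$, $1\le j\le l$, be an ordered string of non-negative integers and let $k=\max\{a_j:1\le j\le l\}$. Then the Kyle graph associated with $s_l$ is constructed on $n=2k+1$ vertices, i.e. it is $O_{2k+1}(s_l)$, and it attains the maximum possible degree $\Delta(O_{2k+1}(s_l))=2\sum_{j=1}^{l}a_j$ at a single vertex.
   Context: An ordered string $s_l=(a_j)$, $1\le j\le l$ ($l\ge 1$), is an $l$-tuple of non-negative integers; $j$ is the index of the entry $a_j$. For a positive integer $n$, the ornated graph $O_n(s_l)$ is the (in general non-simple) directed graph on vertices $v_1,\dots,v_n$ whose arcs, counted with multiplicity, are the following: each odd-indexed entry $a_t$ contributes one arc $(v_i,v_j)$ for every pair $i<j$ with $i+a_t\ge j$; each even-indexed entry $a_s$ contributes one arc $(v_i,v_j)$ for every pair $i>j$ with $i-a_s\le j$. The degree of a vertex is $d(v)=d^+(v)+d^-(v)$ (out-degree plus in-degree, with multiplicity), and $\Delta(O_n(s_l))$ is the maximum degree. The maximum possible degree associated with $s_l$ is $\max_{n\ge 1}\Delta(O_n(s_l))$. The Kyle graph associated with $s_l$ is the ornated graph $O_n(s_l)$ of smallest order $n$ that has a vertex of this maximum possible degree. -}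

module Defs where

open import Algebra.Properties.CommutativeMonoid.Sum using () renaming (sum to sumOver)
open import Data.Bool.Base using (if_then_else_)
open import Data.Fin.Base using (Fin; toℕ)
open import Data.Nat.Base using (ℕ; suc; _+_; _∸_; _⊔_; _≤_; parity)
open import Data.Nat.Properties using (_≤?_; _<?_; +-0-commutativeMonoid)
open import Data.Parity.Base using (Parity; 0ℙ; 1ℙ)
open import Data.Product using (_×_; ∃-syntax)
open import Data.Vec.Functional using (Vector; foldr)
open import Relation.Binary.PropositionalEquality using (_≡_)
open import Relation.Nullary.Decidable using (Dec; does; _×-dec_)

sum : ∀ {n} → Vector ℕ n → ℕ
sum = sumOver +-0-commutativeMonoid

-- On natural numbers the base value 0 does not affect the maximum of a
-- non-empty family.
maximum : ∀ {n} → Vector ℕ n → ℕ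
maximum = foldr _⊔_ 0

OrderedString : ℕ → Set
OrderedString l = Vector ℕ l

-- Finite directed multigraphs on n vertices: G u v is the number of arcs (u , v).
Digraph : ℕ → Set
Digraph n = Fin n → Fin n → ℕ

outDegree inDegree degree : ∀ {n} → Digraph n → Fin n → ℕ
outDegree G v = sum (λ w → G v w)
inDegree  G v = sum (λ w → G w v)
degree    G v = outDegree G v + inDegree G v

Δ : ∀ {n} → Digraph n → ℕ
Δ G = maximum (degree G)

-- String entries and vertices are numbered from 1.
index : ∀ {n} → Fin n → ℕ
index i = suc (toℕ i)

indicator : ∀ {P : Set} → Dec P → ℕ
indicator P? = if does P? then 1 else 0

-- The number of arcs (v_i , v_j) contributed by an entry a whose index has the
-- given parity (1ℙ is odd). Truncation in i ∸ a is harmless, since j ≥ 0.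
arcs : Parity → (a i j : ℕ) → ℕ
arcs 1ℙ a i j = indicator ((i <? j) ×-dec (j ≤? i + a))
arcs 0ℙ a i j = indicator ((j <? i) ×-dec (i ∸ a ≤? j))

O : ∀ (n : ℕ) {l} → OrderedString l → Digraph n
O n s u v = sum (λ t → arcs (parity (index t)) (s t) (index u) (index v))

-- d = max { Δ (O n s) : n ≥ 1 }
IsMaximumPossibleDegree : ∀ {l} → OrderedString l → ℕ → Set
IsMaximumPossibleDegree s d =
  (∃[ n ] (1 ≤ n × Δ (O n s) ≡ d)) ×
  (∀ n → 1 ≤ n → Δ (O n s) ≤ d)

HasVertexOfMaximumPossibleDegree : ∀ {l} → OrderedString l → ℕ → Set
HasVertexOfMaximumPossibleDegree s n =
  ∃[ v ] IsMaximumPossibleDegree s (degree (O n s) v)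

-- The Kyle graph associated with s is O n s for the n singled out here.
IsKyleOrder : ∀ {l} → OrderedString l → ℕ → Set
IsKyleOrder s n =
  1 ≤ n ×
  HasVertexOfMaximumPossibleDegree s n ×
  (∀ m → 1 ≤ m → HasVertexOfMaximumPossibleDegree s m → n ≤ m)

{-# OPTIONS --safe #-}
module Submission where

-- The vertex v_{p+1} of O n s has p vertices before it and n ∸ (p+1) after it,
-- and an entry a of either parity gives it a ⊓ p arcs to or from the former and
-- a ⊓ (n ∸ (p+1)) to or from the latter. Hence the degree is at most 2 Σ a_j,
-- with equality exactly when both numbers are at least k = max a_j.

open import Defs
open import Data.Bool.Base using (if_then_else_)
open import Data.Fin.Base using (Fin; zero; suc; toℕ; fromℕ<)
open import Data.Fin.Properties using (toℕ<n; toℕ≤n; toℕ-fromℕ<; toℕ-injective)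
open import Data.Nat.Base using (ℕ; zero; suc; _+_; _*_; _∸_; _⊓_; _≤_; _<_; z≤n; s≤s; s≤s⁻¹; parity)
open import Data.Nat.Properties
open import Algebra.Properties.CommutativeMonoid.Sum +-0-commutativeMonoid using (sum-cong-≗; ∑-distrib-+; ∑-comm)
open import Data.Nat.Tactic.RingSolver using (solve-∀)
open import Data.Parity.Base using (0ℙ; 1ℙ)
open import Data.Product using (_×_; _,_; map₂; ∃!)
open import Data.Vec.Functional using (Vector)
open import Function.Base using (_∘_)
open import Function.Bundles using (mk⇔)
open import Relation.Binary.PropositionalEquality using (_≡_; refl; sym; trans; cong; cong₂; subst; module ≡-Reasoning)
open import Relation.Nullary.Decidable using (_×-dec_; does-⇔)

sum-mono-≤ : ∀ {n} {f g : Vector ℕ n} → (∀ i → f i ≤ g i) → sum f ≤ sum g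
sum-mono-≤ {zero}  f≤g = z≤n
sum-mono-≤ {suc n} f≤g = +-mono-≤ (f≤g zero) (sum-mono-≤ (f≤g ∘ suc))

+-tight : ∀ {a b c d} → a ≤ c → b ≤ d → c + d ≤ a + b → c ≤ a × d ≤ b
+-tight {a} {b} {c} {d} a≤c b≤d tot =
  +-cancelʳ-≤ d c a (≤-trans tot (+-monoʳ-≤ a b≤d)) ,
  +-cancelˡ-≤ c d b (≤-trans tot (+-monoˡ-≤ b a≤c))

-- Termwise bounds leave no slack once the totals agree. This drives the converse direction: full
-- degree forces every entry to be uncapped.
sum-tight : ∀ {n} {f g : Vector ℕ n} → (∀ i → f i ≤ g i) → sum g ≤ sum f → ∀ i → g i ≤ f i
sum-tight {suc n} f≤g tot with +-tight (f≤g zero) (sum-mono-≤ (f≤g ∘ suc)) tot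
... | head , tail = λ { zero → head ; (suc i) → sum-tight (f≤g ∘ suc) tail i }

≤-maximum : ∀ {n} (f : Vector ℕ n) i → f i ≤ maximum f
≤-maximum f zero    = m≤m⊔n _ _
≤-maximum f (suc i) = ≤-trans (≤-maximum (f ∘ suc) i) (m≤n⊔m (f zero) _)

maximum-lub : ∀ {n m} {f : Vector ℕ n} → (∀ i → f i ≤ m) → maximum f ≤ m
maximum-lub {zero}  f≤m = z≤n
maximum-lub {suc n} f≤m = ⊔-lub (f≤m zero) (maximum-lub (f≤m ∘ suc))

-- Moving `a` across the inequality shows that an even-indexed entry gives the reversed arcs of an
-- odd-indexed one, so only parity `1ℙ` has to be counted.
arcs-0ℙ : ∀ a i j → arcs 0ℙ a i j ≡ arcs 1ℙ a j i
arcs-0ℙ a i j = cong (if_then 1 else 0)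
  (does-⇔ (mk⇔ (map₂ to) (map₂ from)) ((j <? i) ×-dec (i ∸ a ≤? j)) ((j <? i) ×-dec (i ≤? j + a)))
  where
  to : i ∸ a ≤ j → i ≤ j + a
  to p = ≤-trans (m≤n+m∸n i a) (≤-trans (+-monoʳ-≤ a p) (≤-reflexive (+-comm a j)))
  from : i ≤ j + a → i ∸ a ≤ j
  from p = m≤n+o⇒m∸n≤o i a (≤-trans p (≤-reflexive (+-comm j a)))

count-≤ : ∀ n a → sum {n} (λ w → indicator (index w ≤? a)) ≡ a ⊓ n
count-≤ zero    a       = sym (⊓-zeroʳ a)
count-≤ (suc n) zero    = count-≤ n zero
count-≤ (suc n) (suc a) = cong suc (count-≤ n a)

count-after : ∀ n a p → sum {n} (λ w → arcs 1ℙ a (suc p) (index w)) ≡ a ⊓ (n ∸ suc p)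
count-after zero    a p       = sym (⊓-zeroʳ a)
count-after (suc n) a zero    = count-≤ n a
-- The first vertex precedes the given one and counts 0; arcs depend only on index differences, so
-- both indices drop by one.
count-after (suc n) a (suc p) = count-after n a p

⊓-suc : ∀ a p → indicator (suc p ≤? a) + a ⊓ p ≡ a ⊓ suc p
⊓-suc zero    p       = refl
⊓-suc (suc a) zero    = cong suc (sym (⊓-zeroʳ a))
⊓-suc (suc a) (suc p) = trans (+-suc _ _) (cong suc (⊓-suc a p))

count-before : ∀ n a p → p ≤ n → sum {n} (λ w → arcs 1ℙ a (index w) (suc p)) ≡ a ⊓ p
count-before zero    a zero    _         = sym (⊓-zeroʳ a)
count-before (suc n) a zero    _         = count-before n a zero z≤n
-- The first vertex lies at distance `suc p`, hence is reached exactly when `suc p ≤ a`; the other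
-- `p` predecessors are left to the recursion.
count-before (suc n) a (suc p) (s≤s p≤n) =
  trans (cong (indicator (suc p ≤? a) +_) (count-before n a p p≤n)) (⊓-suc a p)

entry-degree : ∀ {n} π a (v : Fin n) →
  sum {n} (λ w → arcs π a (index v) (index w)) + sum {n} (λ w → arcs π a (index w) (index v))
    ≡ a ⊓ (n ∸ index v) + a ⊓ toℕ v
entry-degree {n} 1ℙ a v =
  cong₂ _+_ (count-after n a (toℕ v)) (count-before n a (toℕ v) (toℕ≤n v))
-- Reversing arcs exchanges out-degree and in-degree, so the two summands are swapped first.
entry-degree {n} 0ℙ a v = trans (+-comm (sum {n} _) _) (trans
  (cong₂ _+_ (sum-cong-≗ {n} (λ w → arcs-0ℙ a (index w) (index v)))
             (sum-cong-≗ {n} (λ w → arcs-0ℙ a (index v) (index w))))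
  (entry-degree 1ℙ a v))

cappedSum : ∀ {l} → OrderedString l → ℕ → ℕ
cappedSum s m = sum (λ t → s t ⊓ m)

cappedSum≤sum : ∀ {l} (s : OrderedString l) m → cappedSum s m ≤ sum s
cappedSum≤sum s m = sum-mono-≤ (λ t → m⊓n≤m (s t) m)

cappedSum-full : ∀ {l} (s : OrderedString l) {m} → maximum s ≤ m → cappedSum s m ≡ sum s
cappedSum-full s k≤m = sum-cong-≗ (λ t → m≤n⇒m⊓n≡m (≤-trans (≤-maximum s t) k≤m))

sum≤cappedSum⇒maximum≤ : ∀ {l} (s : OrderedString l) {m} → sum s ≤ cappedSum s m → maximum s ≤ m
sum≤cappedSum⇒maximum≤ s {m} full = maximum-lub λ t →
  ≤-trans (sum-tight (λ u → m⊓n≤m (s u) m) full t) (m⊓n≤n (s t) m)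

degree-O : ∀ {n l} (s : OrderedString l) (v : Fin n) →
  degree (O n s) v ≡ cappedSum s (n ∸ index v) + cappedSum s (toℕ v)
degree-O {n} {l} s v = begin
  degree (O n s) v
    -- Double counting: the arcs at `v` are grouped by entry instead of by the other endpoint.
    ≡⟨ cong₂ _+_ (∑-comm out) (∑-comm in′) ⟩
  sum (λ t → sum (λ w → out w t)) + sum (λ t → sum (λ w → in′ w t))
    ≡⟨ ∑-distrib-+ (λ t → sum (λ w → out w t)) _ ⟨
  sum (λ t → sum (λ w → out w t) + sum (λ w → in′ w t))
    ≡⟨ sum-cong-≗ (λ t → entry-degree (parity (index t)) (s t) v) ⟩
  sum (λ t → s t ⊓ (n ∸ index v) + s t ⊓ toℕ v)
    ≡⟨ ∑-distrib-+ (λ t → s t ⊓ (n ∸ index v)) _ ⟩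
  cappedSum s (n ∸ index v) + cappedSum s (toℕ v) ∎
  where
  open ≡-Reasoning
  out in′ : Fin n → Fin l → ℕ
  out w t = arcs (parity (index t)) (s t) (index v) (index w)
  in′ w t = arcs (parity (index t)) (s t) (index w) (index v)

m+m≡2*m : ∀ m → m + m ≡ 2 * m
m+m≡2*m m = cong (m +_) (sym (+-identityʳ m))

degree-O-≤ : ∀ {n l} (s : OrderedString l) (v : Fin n) → degree (O n s) v ≤ 2 * sum s
degree-O-≤ {n} s v = begin
  degree (O n s) v                                ≡⟨ degree-O s v ⟩
  cappedSum s (n ∸ index v) + cappedSum s (toℕ v) ≤⟨ +-mono-≤ (cappedSum≤sum s _) (cappedSum≤sum s _) ⟩
  sum s + sum s                                   ≡⟨ m+m≡2*m (sum s) ⟩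
  2 * sum s                                       ∎
  where open ≤-Reasoning

Δ-O-≤ : ∀ n {l} (s : OrderedString l) → Δ (O n s) ≤ 2 * sum s
Δ-O-≤ n s = maximum-lub (degree-O-≤ {n} s)

degree-O-full : ∀ {n l} (s : OrderedString l) (v : Fin n) →
  maximum s ≤ n ∸ index v → maximum s ≤ toℕ v → degree (O n s) v ≡ 2 * sum s
degree-O-full s v after before = trans (degree-O s v)
  (trans (cong₂ _+_ (cappedSum-full s after) (cappedSum-full s before)) (m+m≡2*m (sum s)))

degree-O-full⁻¹ : ∀ {n l} (s : OrderedString l) (v : Fin n) →
  2 * sum s ≤ degree (O n s) v → maximum s ≤ n ∸ index v × maximum s ≤ toℕ v
degree-O-full⁻¹ {n} s v full
  with +-tight (cappedSum≤sum s (n ∸ index v)) (cappedSum≤sum s (toℕ v))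
         (≤-trans (≤-reflexive (m+m≡2*m (sum s))) (≤-trans full (≤-reflexive (degree-O s v))))
... | after , before = sum≤cappedSum⇒maximum≤ s after , sum≤cappedSum⇒maximum≤ s before

2*m+1≡m+[1+m] : ∀ m → 2 * m + 1 ≡ m + suc m
2*m+1≡m+[1+m] = solve-∀

lemma2p9 : (l : ℕ) → 1 ≤ l → (s : OrderedString l) →
    let k = maximum s
        n = 2 * k + 1
    in IsKyleOrder s n
       × IsMaximumPossibleDegree s (Δ (O n s))
       × Δ (O n s) ≡ 2 * sum s
       × ∃! _≡_ (λ v → degree (O n s) v ≡ Δ (O n s))
lemma2p9 l 1≤l s =
  (1≤n , (centre , subst (IsMaximumPossibleDegree s) (sym degree≡Δ) isMax) , minimal) ,
  isMax , Δ≡ , centre , degree≡Δ , unique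
  where
  k n : ℕ
  k = maximum s
  n = 2 * k + 1

  1≤n : 1 ≤ n
  1≤n = m≤n+m 1 (2 * k)

  k<n : k < n
  k<n = ≤-trans (m≤n+m (suc k) k) (≤-reflexive (sym (2*m+1≡m+[1+m] k)))

  centre : Fin n
  -- This is the middle vertex, of index `k + 1`, with exactly `k` vertices on each side.
  centre = fromℕ< k<n

  centre≡k : toℕ centre ≡ k
  centre≡k = toℕ-fromℕ< k<n

  n∸centre≡k : n ∸ index centre ≡ k
  n∸centre≡k = trans (cong₂ _∸_ (2*m+1≡m+[1+m] k) (cong suc centre≡k)) (m+n∸n≡m k (suc k))

  degree≡ : degree (O n s) centre ≡ 2 * sum s
  degree≡ = degree-O-full s centre (≤-reflexive (sym n∸centre≡k)) (≤-reflexive (sym centre≡k))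

  Δ≡ : Δ (O n s) ≡ 2 * sum s
  Δ≡ = ≤-antisym (Δ-O-≤ n s)
    (≤-trans (≤-reflexive (sym degree≡)) (≤-maximum (degree (O n s)) centre))

  degree≡Δ : degree (O n s) centre ≡ Δ (O n s)
  degree≡Δ = trans degree≡ (sym Δ≡)

  isMax : IsMaximumPossibleDegree s (Δ (O n s))
  isMax = (n , 1≤n , refl) , λ m _ → ≤-trans (Δ-O-≤ m s) (≤-reflexive (sym Δ≡))

  minimal : ∀ m → 1 ≤ m → HasVertexOfMaximumPossibleDegree s m → n ≤ m
  minimal m _ (v , _ , bound)
    -- The maximality of the degree of `v`, tested on order `n`, makes it at least `2 * sum s`; so
    -- `v` has at least `k` vertices on each side, and counting `v` itself gives `2 * k + 1` in all.
    with degree-O-full⁻¹ s v (≤-trans (≤-reflexive (sym Δ≡)) (bound n 1≤n))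
  ... | after , before = begin
    n           ≡⟨ 2*m+1≡m+[1+m] k ⟩
    k + suc k   ≤⟨ +-monoʳ-≤ k (s≤s before) ⟩
    k + index v ≤⟨ m≤o∸n⇒m+n≤o k (toℕ<n v) after ⟩
    m           ∎
    where open ≤-Reasoning

  unique : ∀ {v} → degree (O n s) v ≡ Δ (O n s) → centre ≡ v
  unique {v} eq with degree-O-full⁻¹ s v (≤-reflexive (sym (trans eq Δ≡)))
  ... | after , before = toℕ-injective (trans centre≡k (≤-antisym before v≤k))
    where
    v≤k : toℕ v ≤ k
    -- The `k` vertices after `v` leave at most `k + 1` positions up to and including `v`. The bound
    -- `toℕ<n v` rules out truncation in `n ∸ index v`.
    v≤k = s≤s⁻¹ (+-cancelˡ-≤ k _ _ (≤-trans (m≤o∸n⇒m+n≤o k (toℕ<n v) after) (≤-reflexive (2*m+1≡m+[1+m] k))))
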